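{- Binary LCP-mergesort, as described in the context, correctly sorts any set $\mathcal{S}$ of $n$ strings and computes its LCP array $H$; it performs at most $L(H) + n\lceil \log_2 n\rceil$ character comparisons and runs in $O(D + n\log n)$ time.
   Context: Strings are finite sequences over a totally ordered alphabet $\Sigma$, terminated by an end-of-string character $0\notin\Sigma$ smaller than all characters; they are ordered lexicographically. $\mathrm{lcp}(s,t)$ is the length of the longest common prefix of $s,t$. For a sorted sequence $s_1\le\dots\le s_n$ its LCP array is $H=(\bot,h_2,\dots,h_n)$ with $h_i=\mathrm{lcp}(s_{i-1},s_i)$, and $L(H)=\sum_{i=2}^n h_i$. The distinguishing prefix size $D$ of $\mathcal{S}$ is the sum over all $s\in\mathcal S$ of the length of the shortest prefix of $s$ (including the terminator if needed) that is not a prefix of any other string of $\mathcal S$ (so $D\ge L(H)$). Let $\varepsilon$ denote the empty string ($\mathrm{lcp}(\varepsilon,s)=0$) and $\infty$ a sentinel string larger than all strings. LCP-Compare: given $(a,s_a,h_a)$ and $(b,s_b,h_b)$ where $h_a=\mathrm{lcp}(p,s_a)$, $h_b=\mathrm{lcp}(p,s_b)$ for some string $p\le s_a,s_b$: if $h_a<h_b$ return $(b,h_b,a,h_a)$; if $h_b<h_a$ return $(a,h_a,b,h_b)$; if $h_a=h_b$, set $h':=h_a$ and compare $s_a[h'+1]$ with $s_b[h'+1]$, incrementing $h'$ while these characters are equal and not the terminator; then return $(a,h_a,b,h')$ if $s_a[h'+1]\le s_b[h'+1]$ and $(b,h_b,a,h')$ otherwise. The returned tuple $(x,h_x,y,h')$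 satisfies $s_x\le s_y$, $\{x,y\}=\{a,b\}$, $h'=\mathrm{lcp}(s_a,s_b)$. Counting convention: each test of the loop condition yielding equality counts as one character comparison, and the final failing test together with the subsequent $\le$ test counts as one (ternary) comparison; cases $h_a\ne h_b$ use no character comparisons. Binary LCP-merge: given sorted $\mathcal S_1,\mathcal S_2$ with LCP arrays $H_1,H_2$ (with sentinel $\infty$ at the end of each), keep indices $i_1,i_2$ (initially 1) and values $h_1=h_2=0$, maintaining $h_k=\mathrm{lcp}(\mathcal S_k[i_k], \text{last output string})$ (last output initially $\varepsilon$). While input remains: call LCP-Compare on $(1,\mathcal S_1[i_1],h_1)$ and $(2,\mathcal S_2[i_2],h_2)$ obtaining $(x,\cdot,y,h')$; append $\mathcal S_x[i_x]$ to the output with LCP entry $h_x$; increment $i_x$; set $h_x:=H_x[i_x]$ and $h_y:=h'$. Binary LCP-mergesort: a set of size $\le 1$ is returned as is; otherwise split into parts of sizes $\lfloor n/2\rfloor$ and $\lceil n/2\rceil$, sort each recursively (with LCP arrays), and combine them with binary LCP-merge. -}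

module Defs where

open import Data.Bool.Base using (Bool; true; false)
open import Data.List.Base using (List; []; _∷_; map; length; take; drop; inits; find)
open import Data.List.Properties using (≡-dec; length-take; length-drop)
open import Data.List.Relation.Unary.All using (All; all?)
open import Data.List.Relation.Binary.Prefix.Heterogeneous using (Prefix)
open import Data.List.Relation.Binary.Prefix.Heterogeneous.Properties using (prefix?)
import Data.List.Relation.Binary.Lex.Strict as Lex
open import Data.Maybe.Base using (maybe′)
open import Data.Nat.Base using (ℕ; zero; suc; _+_; ⌊_/2⌋; s≤s; z≤n)
  renaming (_<_ to _<ℕ_)
open import Data.Nat.Induction using (<-wellFounded)
open import Data.Nat.ListAction using (sum)
open import Data.Nat.Properties using (<-cmp; ⌊n/2⌋<n; m⊓n≤m; ∸-monoʳ-<; ≤-<-trans; ⌊n/2⌋≤n)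
open import Data.Product.Base using (_×_; _,_; proj₁; proj₂)
open import Induction.WellFounded using (Acc; acc)
open import Level using (Level; _⊔_)
open import Relation.Binary.Bundles using (StrictTotalOrder; DecTotalOrder; TotalOrder)
open import Relation.Binary.Core using (Rel)
open import Relation.Binary.Definitions using (Tri; tri<; tri≈; tri>; DecidableEquality)
open import Relation.Binary.Structures using (IsStrictTotalOrder)
import Relation.Binary.Construct.Add.Infimum.Strict as AddInfimum
import Relation.Binary.Construct.Add.Extrema.Strict as AddExtrema
import Relation.Binary.Construct.On as On
open import Relation.Binary.PropositionalEquality.Core using (_≡_; _≢_; sym; subst)
open import Relation.Nullary.Construct.Add.Infimum as Inf using (_₋; ⊥₋)
open import Relation.Nullary.Construct.Add.Supremum as Sup using (_⁺)
open import Relation.Nullary.Construct.Add.Extrema as Ext using (_±; ⊥±; ⊤±)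
open import Relation.Nullary.Decidable.Core using (yes; no; ¬?; _→-dec_)
open import Relation.Nullary.Negation.Core using (¬_)
open import Relation.Unary using (Decidable)

private
  variable
    b c : Level
    X : Set b
    Y : Set c

-- Cost model: unit-cost random access machine.  Strings are handled by
-- reference, so reading one character, copying a reference, appending an entry
-- and handling a number each take one time unit.  Every such operation of the
-- algorithm goes through `op`; character comparisons go through `compareChars`
-- below, which is the only source of `comparisons`.

record Run (X : Set b) : Set b where
  constructor run
  field
    result      : X
    comparisons : ℕ
    time        : ℕ

open Run public

return : X → Run X
return x = run x 0 0

infixl 1 _>>=_

_>>=_ : Run X → (X → Run Y) → Run Y
run x k t >>= f = run (result (f x)) (k + comparisons (f x)) (t + time (f x))

ops : ℕ → X → Run X
ops t x = run x 0 t

op : X → Run X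
op = ops 1

data Side : Set where
  left right : Side

module LCPMergesort {a ℓ} {A : Set a} {_<_ : Rel A ℓ}
                    (isSTO : IsStrictTotalOrder _≡_ _<_) where

  open IsStrictTotalOrder isSTO using (compare; _≟_)
  open AddInfimum _<_ using (_<₋_; <₋-isStrictTotalOrder-≡)
  open AddExtrema _<_ using (_<±_; <±-cmp-≡)

  String : Set a
  String = List A

  _≟ₛ_ : DecidableEquality String
  _≟ₛ_ = ≡-dec _≟_

  -- The terminator is ⊥₋.
  terminated : String → List (A ₋)
  terminated []      = ⊥₋ ∷ []
  terminated (x ∷ s) = Inf.[ x ] ∷ terminated s

  stringOrder : TotalOrder a a (a ⊔ ℓ)
  stringOrder = DecTotalOrder.totalOrder (On.decTotalOrder lex terminated)
    where
    lex : DecTotalOrder _ _ _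
    lex = Lex.≤-decTotalOrder
            (record { isStrictTotalOrder = <₋-isStrictTotalOrder-≡ isSTO })

  lcp : String → String → ℕ
  lcp []      _       = 0
  lcp (_ ∷ _) []      = 0
  lcp (x ∷ s) (y ∷ t) with x ≟ y
  ... | yes _ = suc (lcp s t)
  ... | no  _ = 0

  adjacentLCPs : String → List String → List ℕ
  adjacentLCPs s []      = []
  adjacentLCPs s (t ∷ S) = lcp s t ∷ adjacentLCPs t S

  -- The undefined first entry ⊥ of an LCP array is represented by 0, which is
  -- what merging writes there (the LCP with the empty string).
  lcpArray : List String → List ℕ
  lcpArray []      = []
  lcpArray (s ∷ S) = 0 ∷ adjacentLCPs s S

  L : List ℕ → ℕ
  L H = sum (drop 1 H)

  Distinguishes : List String → String → List (A ₋) → Set a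
  Distinguishes S s p = All (λ t → t ≢ s → ¬ Prefix _≡_ p (terminated t)) S

  distinguishes? : ∀ S s → Decidable (Distinguishes S s)
  distinguishes? S s p =
    all? (λ t → ¬? (t ≟ₛ s) →-dec ¬? (prefix? (Inf.≡-dec _≟_) p (terminated t))) S

  -- `inits` lists prefixes by increasing length.  The search always succeeds,
  -- since `terminated s` is not a prefix of `terminated t` for t ≢ s.
  distinguishingLength : List String → String → ℕ
  distinguishingLength S s =
    maybe′ length 0 (find (distinguishes? S s) (inits (terminated s)))

  D : List String → ℕ
  D S = sum (map (distinguishingLength S) S)

  -- Strings together with the sentinel ∞, whose characters are all ⊤±.
  String∞ : Set a
  String∞ = String ⁺

  pattern fin s = Sup.[ s ]
  pattern ∞     = Sup.⊤⁺

  length∞ : String∞ → ℕ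
  length∞ (fin s) = length s
  length∞ ∞       = 0

  -- 0-based: `charAt s h` is the character s[h+1].
  charAt : String∞ → ℕ → A ±
  charAt ∞             _       = ⊤±
  charAt (fin [])      _       = ⊥±
  charAt (fin (x ∷ _)) zero    = Ext.[ x ]
  charAt (fin (_ ∷ s)) (suc i) = charAt (fin s) i

  isTerminator : A ± → Bool
  isTerminator ⊥±        = true
  isTerminator Ext.[ _ ] = false
  isTerminator ⊤±        = false

  -- One ternary comparison.  An outcome `tri≈` on a non-terminator is a loop
  -- test yielding equality; any other outcome is the final failing loop test
  -- merged with the subsequent ≤ test.
  compareChars : (x y : A ±) → Run (Tri (x <± y) (x ≡ y) (y <± x))
  compareChars x y = run (<±-cmp-≡ compare x y) 1 1

  -- `scan n s t h` is the character loop of LCP-Compare started at h′ = h.  It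
  -- returns whether s[h′+1] ≤ t[h′+1] holds at the end, and the final h′.  The
  -- bound n on the number of increments only serves termination: with
  -- n = length∞ s the loop stops at the terminator of s before n runs out.
  scan     : ℕ → String∞ → String∞ → ℕ → Run (Bool × ℕ)
  scanTest : ∀ {p q r} {P : Set p} {Q : Set q} {R : Set r} →
             ℕ → String∞ → String∞ → ℕ → Tri P Q R → Run (Bool × ℕ)
  scanNext : ℕ → String∞ → String∞ → ℕ → Bool → Run (Bool × ℕ)

  scan n s t h = do
    x ← op (charAt s h)
    y ← op (charAt t h)
    o ← compareChars x y
    scanTest n s t h o

  scanTest n s t h (tri< _ _ _) = return (true , h)
  scanTest n s t h (tri> _ _ _) = return (false , h)
  scanTest n s t h (tri≈ _ _ _) = do
    end ← op (isTerminator (charAt s h))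
    scanNext n s t h end

  scanNext _       s t h true  = return (true , h)
  scanNext zero    s t h false = return (true , h)
  scanNext (suc n) s t h false = do
    h′ ← op (suc h)
    scan n s t h′

  -- Inputs are (label, string, LCP) triples; the output is (x, h_x, y, h′) with
  -- labels x, y.
  module _ {I : Set} where

    lcpCompareEqual : (a : I) (h_a : ℕ) (b : I) (h_b : ℕ) → Bool × ℕ → Run (I × ℕ × I × ℕ)
    lcpCompareEqual a h_a b h_b (true  , h′) = op (a , h_a , b , h′)
    lcpCompareEqual a h_a b h_b (false , h′) = op (b , h_b , a , h′)

    lcpCompareCases : ∀ {p q r} {P : Set p} {Q : Set q} {R : Set r} →
                      I × String∞ × ℕ → I × String∞ × ℕ → Tri P Q R → Run (I × ℕ × I × ℕ)
    lcpCompareCases (a , s_a , h_a) (b , s_b , h_b) (tri< _ _ _) = op (b , h_b , a , h_a)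
    lcpCompareCases (a , s_a , h_a) (b , s_b , h_b) (tri> _ _ _) = op (a , h_a , b , h_b)
    lcpCompareCases (a , s_a , h_a) (b , s_b , h_b) (tri≈ _ _ _) = do
      r ← scan (length∞ s_a) s_a s_b h_a
      lcpCompareEqual a h_a b h_b r

    lcpCompare : I × String∞ × ℕ → I × String∞ × ℕ → Run (I × ℕ × I × ℕ)
    lcpCompare α@(_ , _ , h_a) β@(_ , _ , h_b) = do
      o ← op (<-cmp h_a h_b)
      lcpCompareCases α β o

  -- A sequence of strings paired with its LCP array.  In the merge loop, the
  -- not yet consumed suffix of such a list plays the role of the index i_k.
  Annotated : Set a
  Annotated = List (String × ℕ)

  current : Annotated → String∞
  current []            = ∞
  current ((s , _) ∷ _) = fin s

  -- The sentinel's LCP entry is 0.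
  currentLCP : Annotated → ℕ
  currentLCP []            = 0
  currentLCP ((_ , h) ∷ _) = h

  append : String∞ → ℕ → Annotated → Annotated
  append (fin s) h rest = (s , h) ∷ rest
  append ∞       _ rest = rest

  -- Every iteration consumes one string, so "while input remains" amounts to as
  -- many iterations as there are input strings; the first argument is the
  -- number of strings left.
  mergeLoop : ℕ → Annotated → ℕ → Annotated → ℕ → Run Annotated
  mergeStep : ℕ → Annotated → ℕ → Annotated → ℕ → Side × ℕ × Side × ℕ → Run Annotated

  mergeLoop zero    S₁ h₁ S₂ h₂ = op []
  mergeLoop (suc n) S₁ h₁ S₂ h₂ = do
    _  ← op n
    s₁ ← op (current S₁)
    s₂ ← op (current S₂)
    r  ← lcpCompare (left , s₁ , h₁) (right , s₂ , h₂)
    mergeStep n S₁ h₁ S₂ h₂ r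

  mergeStep n S₁ h₁ S₂ h₂ (left , h_x , _ , h′) = do
    S₁⁺  ← op (drop 1 S₁)
    h₁⁺  ← op (currentLCP S₁⁺)
    h₂⁺  ← op h′
    rest ← mergeLoop n S₁⁺ h₁⁺ S₂ h₂⁺
    op (append (current S₁) h_x rest)
  mergeStep n S₁ h₁ S₂ h₂ (right , h_x , _ , h′) = do
    S₂⁺  ← op (drop 1 S₂)
    h₂⁺  ← op (currentLCP S₂⁺)
    h₁⁺  ← op h′
    rest ← mergeLoop n S₁ h₁⁺ S₂⁺ h₂⁺
    op (append (current S₂) h_x rest)

  lcpMerge : Annotated → Annotated → Run Annotated
  lcpMerge S₁ S₂ = mergeLoop (length S₁ + length S₂) S₁ 0 S₂ 0

  firstHalf secondHalf : List String → List String
  firstHalf  S = take ⌊ length S /2⌋ S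
  secondHalf S = drop ⌊ length S /2⌋ S

  firstHalf-shorter : ∀ s t S → length (firstHalf (s ∷ t ∷ S)) <ℕ length (s ∷ t ∷ S)
  firstHalf-shorter s t S =
    subst (_<ℕ length U) (sym (length-take ⌊ length U /2⌋ U))
      (≤-<-trans (m⊓n≤m ⌊ length U /2⌋ (length U)) (⌊n/2⌋<n (suc (length S))))
    where
    U : List String
    U = s ∷ t ∷ S

  secondHalf-shorter : ∀ s t S → length (secondHalf (s ∷ t ∷ S)) <ℕ length (s ∷ t ∷ S)
  secondHalf-shorter s t S =
    subst (_<ℕ length U) (sym (length-drop ⌊ length U /2⌋ U))
      (∸-monoʳ-< {o = 0} (s≤s z≤n) (⌊n/2⌋≤n (length U)))
    where
    U : List String
    U = s ∷ t ∷ S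

  -- Splitting is charged linear time, as for linked lists.
  mergesortAcc : (S : List String) → Acc _<ℕ_ (length S) → Run Annotated
  mergesortAcc []                _        = op []
  mergesortAcc (s ∷ [])          _        = op ((s , 0) ∷ [])
  mergesortAcc U@(s ∷ t ∷ S)     (acc rs) = do
    _  ← ops (length U) U
    T₁ ← mergesortAcc (firstHalf U) (rs (firstHalf-shorter s t S))
    T₂ ← mergesortAcc (secondHalf U) (rs (secondHalf-shorter s t S))
    lcpMerge T₁ T₂

  lcpMergesort : List String → Run Annotated
  lcpMergesort S = mergesortAcc S (<-wellFounded (length S))

  strings : Annotated → List String
  strings = map proj₁

  lcps : Annotated → List ℕ
  lcps = map proj₂

{-# OPTIONS --safe #-}

-- Strings are compared pointwise: s <[ h ] t means that s and t agree before
-- position h and that s has the smaller character there, so that s < t and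
-- lcp(s,t) = h.  If p <[ h₁ ] s₁ and p <[ h₂ ] s₂ then unequal h₁, h₂ decide the
-- comparison of s₁ with s₂, and equal ones give a common prefix from which the
-- character loop can start.  Each equality test that succeeds in that loop
-- raises one stored LCP by one, while everything else a merging step does only
-- moves LCP values around.  A merge therefore makes exactly L(H) − L(H₁) − L(H₂)
-- successful equality tests, besides at most one failing test per string.

module Submission where

open import Defs
open import Data.Bool.Base using (Bool; true; false)
open import Data.List.Base using (List; []; _∷_; _++_; length; map; inits; find)
open import Data.List.Membership.Propositional using (_∈_)
open import Data.List.Properties using (length-++; length-drop; length-map; length-take; take++drop≡id)
open import Data.List.Relation.Binary.Disjoint.Propositional using (Disjoint)
open import Data.List.Relation.Binary.Lex.Core using (this; next)
open import Data.List.Relation.Binary.Permutation.Propositional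
  using (_↭_; ↭-sym; ↭-trans; prep; refl)
open import Data.List.Relation.Binary.Permutation.Propositional.Properties
  using (∈-resp-↭; ++⁺; map⁺; shift; ↭-length)
import Data.List.Relation.Binary.Pointwise.Properties as Pointwise
open import Data.List.Relation.Binary.Prefix.Heterogeneous using (Prefix; []; _∷_)
import Data.List.Relation.Binary.Prefix.Heterogeneous.Properties as Prefix
open import Data.List.Relation.Unary.All as All using (All; []; _∷_)
import Data.List.Relation.Unary.All.Properties as All
open import Data.List.Relation.Unary.AllPairs using ([]; _∷_)
open import Data.List.Relation.Unary.Any as Any using (Any; here; there)
import Data.List.Relation.Unary.Any.Properties as Any
open import Data.List.Relation.Unary.Linked using ([]; [-]; _∷_)
open import Data.List.Relation.Unary.Sorted.TotalOrder using (Sorted)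
open import Data.List.Relation.Unary.Unique.Propositional using (Unique)
open import Data.List.Relation.Unary.Unique.Propositional.Properties using (take⁺; drop⁺)
open import Data.Maybe.Base using (Maybe; just; nothing; maybe′)
open import Data.Nat.Base
  using (ℕ; zero; suc; _+_; _*_; _∸_; _≤_; z≤n; s≤s; ⌊_/2⌋; ⌈_/2⌉)
  renaming (_<_ to _<ℕ_)
open import Data.Nat.Induction using (<-wellFounded)
open import Data.Nat.ListAction using (sum)
open import Data.Nat.ListAction.Properties using (sum-↭)
open import Data.Nat.Logarithm using (⌈log₂_⌉; ⌈log₂⌉-mono-≤; ⌈log₂⌈n/2⌉⌉≡⌈log₂n⌉∸1)
open import Data.Nat.Properties hiding (_≟_)
open import Data.Nat.Tactic.RingSolver using (solve-∀)
open import Data.Product.Base using (_×_; _,_; ∃; proj₁)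
open import Data.Sum.Base using (inj₁; inj₂)
open import Induction.WellFounded using (Acc; acc)
open import Level using (_⊔_)
open import Relation.Binary.Bundles using (TotalOrder)
open import Relation.Binary.Core using (Rel)
open import Relation.Binary.Definitions using (tri<; tri≈; tri>)
open import Relation.Binary.PropositionalEquality.Core
  using (_≡_; _≢_; refl; sym; trans; cong; cong₂; subst)
open import Relation.Binary.Structures using (IsStrictTotalOrder)
import Relation.Binary.Construct.Add.Extrema.Strict as AddExtrema
import Relation.Binary.Construct.Add.Infimum.Strict as AddInfimum
import Relation.Binary.Construct.Add.Supremum.Strict as AddSupremum
open import Relation.Nullary.Construct.Add.Extrema using (⊥±; ⊤±)
open import Relation.Nullary.Decidable.Core using (yes; no)
open import Relation.Nullary.Negation.Core using (contradiction)
open import Relation.Unary using (Pred; Decidable)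

-- Disjointness, `find` and `inits` on lists

Unique-++⇒Disjoint : ∀ {b} {X : Set b} (xs : List X) {ys} → Unique (xs ++ ys) → Disjoint xs ys
Unique-++⇒Disjoint (x ∷ xs) (x∉ ∷ _) (here refl , v∈ys) =
  All.lookup (All.++⁻ʳ xs x∉) v∈ys refl
Unique-++⇒Disjoint (x ∷ xs) (_ ∷ u) (there v∈xs , v∈ys) =
  Unique-++⇒Disjoint xs u (v∈xs , v∈ys)

-- The witness rules out the default 0 of `maybe′`, and whatever `find` returns satisfies `P`.
find-bounded-below : ∀ {b p} {X : Set b} {P : Pred X p} (P? : Decidable P) (f : X → ℕ) {h xs} →
                     Any P xs → All (λ x → P x → h ≤ f x) xs → h ≤ maybe′ f 0 (find P? xs)
find-bounded-below P? f {xs = x ∷ xs} any (h≤ ∷ hs) with P? x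
... | yes px = h≤ px
... | no ¬px = find-bounded-below P? f (Any.tail ¬px any) hs

∈-inits : ∀ {b} {X : Set b} (xs : List X) → xs ∈ inits xs
∈-inits []       = here refl
∈-inits (x ∷ xs) = there (Any.map⁺ (Any.map (cong (x ∷_)) (∈-inits xs)))

module Correctness {a ℓ} {A : Set a} {_<_ : Rel A ℓ}
                   (isSTO : IsStrictTotalOrder _≡_ _<_) where

  open LCPMergesort isSTO
  open IsStrictTotalOrder isSTO using (compare; _≟_; irrefl)
  open AddExtrema _<_ using (_<±_; <±-cmp-≡; ⊥±<[_]; ⊥±<⊤±; [_]<⊤±; [_])
  open AddInfimum _<_ using (_<₋_; ⊥₋<[_]) renaming ([_] to [_]₋)
  open AddSupremum _<₋_ using () renaming ([_] to [_]⁺)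

  private
    variable
      s t u : String∞
      x y z : String
      h h₁ h₂ : ℕ

  -- Strings as sequences of characters

  -- `charAt` pads a finite string with `⊥±` and reads `∞` as `⊤±` throughout, so ends of strings
  -- and the sentinel compare like ordinary characters.
  AgreeBefore : ℕ → String∞ → String∞ → Set a
  AgreeBefore h s t = ∀ i → i <ℕ h → charAt s i ≡ charAt t i

  infix 4 _<[_]_

  record _<[_]_ (s : String∞) (h : ℕ) (t : String∞) : Set (a ⊔ ℓ) where
    constructor _,_
    field
      agree : AgreeBefore h s t
      below : charAt s h <± charAt t h

  open _<[_]_

  agreeBefore-sym : AgreeBefore h s t → AgreeBefore h t s
  agreeBefore-sym eq i i<h = sym (eq i i<h)

  agreeBefore-suc : AgreeBefore h s t → charAt s h ≡ charAt t h → AgreeBefore (suc h) s t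
  agreeBefore-suc {h} eq eqₕ i i<1+h with m≤n⇒m<n∨m≡n (≤-pred i<1+h)
  ... | inj₁ i<h  = eq i i<h
  ... | inj₂ refl = eqₕ

  isTerminator⇒≡⊥ : ∀ c → isTerminator c ≡ true → c ≡ ⊥±
  isTerminator⇒≡⊥ ⊥± _ = refl

  -- Were one string longer, one of its characters before `h` would face the terminator of the
  -- other. So the loop cannot stop on equality when the strings differ.
  terminate-together : ∀ s t h → AgreeBefore h s t →
                       charAt s h ≡ ⊥± → charAt t h ≡ ⊥± → s ≡ t
  terminate-together (fin [])      (fin [])      _       eq _ _ = refl
  terminate-together (fin [])      (fin (_ ∷ _)) (suc h) eq _ _ with () ← eq 0 (s≤s z≤n)
  terminate-together (fin (_ ∷ _)) (fin [])      (suc h) eq _ _ with () ← eq 0 (s≤s z≤n)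
  terminate-together (fin (_ ∷ s)) (fin (_ ∷ t)) (suc h) eq p q
    with refl ← eq 0 (s≤s z≤n)
       | refl ← terminate-together (fin s) (fin t) h (λ i i<h → eq (suc i) (s≤s i<h)) p q
       = refl

  beyond-end : ∀ s h → length∞ s ≤ h → isTerminator (charAt s h) ≡ false → s ≡ ∞
  beyond-end ∞             _       _         _ = refl
  beyond-end (fin (_ ∷ s)) (suc h) (s≤s len) e with () ← beyond-end (fin s) h len e

  charAt≡⊤⇒∞ : ∀ s h → charAt s h ≡ ⊤± → s ≡ ∞
  charAt≡⊤⇒∞ ∞             _       _ = refl
  charAt≡⊤⇒∞ (fin (_ ∷ s)) (suc h) e with () ← charAt≡⊤⇒∞ (fin s) h e

  fin<∞ : ∀ x → fin x <[ 0 ] ∞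
  fin<∞ []      = (λ _ ()) , ⊥±<⊤±
  fin<∞ (c ∷ _) = (λ _ ()) , [ c ]<⊤±

  fin<∞⇒≡0 : fin x <[ h ] ∞ → h ≡ 0
  fin<∞⇒≡0 {h = zero}              _        = refl
  fin<∞⇒≡0 {x = []}    {h = suc _} (eq , _) with () ← eq 0 (s≤s z≤n)
  fin<∞⇒≡0 {x = _ ∷ _} {h = suc _} (eq , _) with () ← eq 0 (s≤s z≤n)

  -- Consequences for lcp, the string order and distinguishing prefixes

  -- Inductive form of `_<[_]_` on finite strings: the pointwise form suits the character loop, this
  -- one recursion along the strings.
  data Precedes : String → ℕ → String → Set (a ⊔ ℓ) where
    halt : ∀ {d y} → Precedes [] 0 (d ∷ y)
    this : ∀ {c d x y} → c < d → Precedes (c ∷ x) 0 (d ∷ y)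
    next : ∀ {c x h y} → Precedes x h y → Precedes (c ∷ x) (suc h) (c ∷ y)

  precedes : ∀ x h y → fin x <[ h ] fin y → Precedes x h y
  -- Here `[ () ]⁺` holds because nothing lies below the terminator.
  precedes []      zero    []      (_ , [ () ]⁺)
  precedes []      zero    (_ ∷ _) _             = halt
  precedes (_ ∷ _) zero    []      (_ , [ () ]⁺)
  precedes (_ ∷ _) zero    (_ ∷ _) (_ , [ c<d ]) = this c<d
  precedes []      (suc h) []      (_ , [ () ]⁺)
  precedes []      (suc h) (_ ∷ _) (eq , _) with () ← eq 0 (s≤s z≤n)
  precedes (_ ∷ _) (suc h) []      (eq , _) with () ← eq 0 (s≤s z≤n)
  precedes (_ ∷ x) (suc h) (_ ∷ y) (eq , lt) with refl ← eq 0 (s≤s z≤n) =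
    next (precedes x h y ((λ i i<h → eq (suc i) (s≤s i<h)) , lt))

  precedes⇒lcp : Precedes x h y → lcp x y ≡ h
  precedes⇒lcp halt = refl
  precedes⇒lcp (this {c} {d} c<d) with c ≟ d
  ... | yes c≡d = contradiction c<d (irrefl c≡d)
  ... | no  _   = refl
  precedes⇒lcp (next {c} p) with c ≟ c
  ... | yes _  = cong suc (precedes⇒lcp p)
  ... | no c≢c = contradiction refl c≢c

  open TotalOrder stringOrder using () renaming (_≤_ to _≤ₛ_)

  precedes⇒≤ : Precedes x h y → x ≤ₛ y
  precedes⇒≤ halt       = this ⊥₋<[ _ ]
  precedes⇒≤ (this c<d) = this [ c<d ]₋
  precedes⇒≤ (next p)   = next refl (precedes⇒≤ p)

  precedes⇒≢ : Precedes x h y → x ≢ y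
  precedes⇒≢ (this c<d) refl = irrefl refl c<d
  precedes⇒≢ (next p)   refl = precedes⇒≢ p refl

  precedes⇒prefix : ∀ {q} → Precedes x h y → Prefix _≡_ q (terminated y) →
                    length q ≤ h → Prefix _≡_ q (terminated x)
  precedes⇒prefix {q = []}    _        _          _         = []
  precedes⇒prefix {q = _ ∷ _} (next p) (refl ∷ q) (s≤s len) = refl ∷ precedes⇒prefix p q len

  terminated-prefix : ∀ x y → Prefix _≡_ (terminated x) (terminated y) → x ≡ y
  terminated-prefix []      []      _          = refl
  terminated-prefix (c ∷ x) (d ∷ y) (refl ∷ p) = cong (c ∷_) (terminated-prefix x y p)
  terminated-prefix []      (_ ∷ _) (() ∷ _)
  terminated-prefix (_ ∷ _) []      (() ∷ _)

  terminated-distinguishes : ∀ S x → Distinguishes S x (terminated x)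
  terminated-distinguishes S x =
    All.tabulate λ {y} _ y≢x p → y≢x (sym (terminated-prefix x y p))

  -- A prefix of `y` shorter than `h` is also a prefix of `x`, a different string of `S`, so it does
  -- not distinguish `y`.
  precedes⇒≤distinguishingLength : ∀ S → x ∈ S → Precedes x h y → h ≤ distinguishingLength S y
  precedes⇒≤distinguishingLength {y = y} S x∈S p =
    find-bounded-below (distinguishes? S y) length
      -- The search cannot fail: the whole of `terminated y` distinguishes `y`.
      (Any.map (λ { refl → terminated-distinguishes S y }) (∈-inits (terminated y)))
      (All.map longer (Prefix.inits⁺ (Pointwise.refl refl)))
    where
    longer : ∀ {q} → Prefix _≡_ q (terminated y) → Distinguishes S y q → _ ≤ length q
    longer q-prefix dist = ≮⇒≥ λ len<h →
      All.lookup dist x∈S (precedes⇒≢ p) (precedes⇒prefix p q-prefix (<⇒≤ len<h))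

  -- Annotated sequences

  -- The LCP with the last output string; before the first output, the latter is
  -- `nothing` rather than ε, so that the relation to a predecessor is strict.
  data Follows : Maybe String → ℕ → String∞ → Set (a ⊔ ℓ) where
    start : Follows nothing 0 s
    after : fin x <[ h ] s → Follows (just x) h s

  -- Strict order and correct LCP entries in one invariant, indexed by the predecessor of the first
  -- entry.
  data Chain : Maybe String → Annotated → Set (a ⊔ ℓ) where
    []  : ∀ {p} → Chain p []
    _∷_ : ∀ {p S} → Follows p h (fin x) → Chain (just x) S → Chain p ((x , h) ∷ S)

  follows-∞ : ∀ {p} → Follows p h ∞ → h ≡ 0
  follows-∞ start     = refl
  follows-∞ (after d) = fin<∞⇒≡0 d

  chain-current : ∀ {S} → Chain (just x) S → Follows (just x) (currentLCP S) (current S)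
  chain-current []      = after (fin<∞ _)
  chain-current (f ∷ _) = f

  chain-sorted : ∀ {p S} → Chain p S → Sorted stringOrder (strings S)
  chain-sorted []                   = []
  chain-sorted (_ ∷ [])             = [-]
  chain-sorted (_ ∷ c@(after d ∷ _)) = precedes⇒≤ (precedes _ _ _ d) ∷ chain-sorted c

  chain-adjacentLCPs : ∀ {S} → Chain (just x) S → lcps S ≡ adjacentLCPs x (strings S)
  chain-adjacentLCPs []            = refl
  chain-adjacentLCPs (after d ∷ c) =
    cong₂ _∷_ (sym (precedes⇒lcp (precedes _ _ _ d))) (chain-adjacentLCPs c)

  chain-lcpArray : ∀ {S} → Chain nothing S → lcps S ≡ lcpArray (strings S)
  chain-lcpArray []          = refl
  chain-lcpArray (start ∷ c) = cong (0 ∷_) (chain-adjacentLCPs c)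

  chain-L : ∀ {S} → Chain nothing S → sum (lcps S) ≡ L (lcps S)
  chain-L []          = refl
  chain-L (start ∷ _) = refl

  chain-sum≤ : ∀ U {S} → Chain (just x) S → x ∈ U → All (_∈ U) (strings S) →
               sum (lcps S) ≤ sum (map (distinguishingLength U) (strings S))
  chain-sum≤ U []            _   _            = z≤n
  chain-sum≤ U (after d ∷ c) x∈U (y∈U ∷ S⊆U) =
    +-mono-≤ (precedes⇒≤distinguishingLength U x∈U (precedes _ _ _ d)) (chain-sum≤ U c y∈U S⊆U)

  -- Each LCP entry is charged to the later of its two strings, so no string is charged twice.
  L≤D : ∀ U {S} → Chain nothing S → strings S ↭ U → L (lcps S) ≤ D U
  L≤D U {S} chain perm = ≤-trans (bound chain (All.tabulate (∈-resp-↭ perm)))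
    (≤-reflexive (sum-↭ (map⁺ (distinguishingLength U) perm)))
    where
    bound : ∀ {S} → Chain nothing S → All (_∈ U) (strings S) →
            L (lcps S) ≤ sum (map (distinguishingLength U) (strings S))
    bound []      _           = z≤n
    bound (_ ∷ c) (x∈U ∷ S⊆U) = ≤-trans (chain-sum≤ U c x∈U S⊆U) (m≤n+m _ _)

  -- The character loop and LCP-Compare

  -- e is the number of equality tests that succeeded.
  data Scanned (s t : String∞) (h : ℕ) : Run (Bool × ℕ) → Set (a ⊔ ℓ) where
    before : ∀ e {h′} → h′ ≡ e + h → s <[ h′ ] t →
             Scanned s t h (run (true , h′) (suc e) (3 + e * 5))
    behind : ∀ e {h′} → h′ ≡ e + h → t <[ h′ ] s →
             Scanned s t h (run (false , h′) (suc e) (3 + e * 5))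

  -- A successful test costs 5: two reads, the comparison, the terminator test and the increment.
  scanned-suc : ∀ {r} → Scanned s t (suc h) r →
                Scanned s t h (run (result r) (1 + comparisons r) (5 + time r))
  scanned-suc (before e eq lt) = before (suc e) (trans eq (+-suc e _)) lt
  scanned-suc (behind e eq lt) = behind (suc e) (trans eq (+-suc e _)) lt

  -- Since `s ≢ t`, the loop ends on a strict inequality; the length bound says that the fuel
  -- reaches the end of `s`.
  scan-correct : ∀ n s t h → s ≢ t → length∞ s ≤ h + n → AgreeBefore h s t →
                 Scanned s t h (scan n s t h)

  -- The added 1 and 4 pay for the test just made: two reads, one comparison and the terminator
  -- test.
  scanNext-correct : ∀ n s t h → s ≢ t → length∞ s ≤ h + n → AgreeBefore h s t →
                     charAt s h ≡ charAt t h → ∀ b → isTerminator (charAt s h) ≡ b →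
                     let r = scanNext n s t h b in
                     Scanned s t h (run (result r) (1 + comparisons r) (4 + time r))
  scanNext-correct n s t h s≢t len eq eqₕ true term =
    contradiction (terminate-together s t h eq s≡⊥ (trans (sym eqₕ) s≡⊥)) s≢t
    where
    s≡⊥ : charAt s h ≡ ⊥±
    s≡⊥ = isTerminator⇒≡⊥ (charAt s h) term
  -- Out of fuel on a non-terminator means that `s` is `∞`; the equal character `⊤±` makes `t` the
  -- sentinel as well.
  scanNext-correct zero s t h s≢t len eq eqₕ false term
    with refl ← beyond-end s h (≤-trans len (≤-reflexive (+-identityʳ h))) term =
    contradiction (sym (charAt≡⊤⇒∞ t h (sym eqₕ))) s≢t
  scanNext-correct (suc n) s t h s≢t len eq eqₕ false _ =
    scanned-suc (scan-correct n s t (suc h) s≢t (≤-trans len (≤-reflexive (+-suc h n)))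
      (agreeBefore-suc {s = s} {t} eq eqₕ))

  scan-correct n s t h s≢t len eq with <±-cmp-≡ compare (charAt s h) (charAt t h)
  ... | tri< lt _ _ = before 0 refl (eq , lt)
  ... | tri> _ _ gt = behind 0 refl (agreeBefore-sym {s = s} {t} eq , gt)
  ... | tri≈ _ eqₕ _ = scanNext-correct n s t h s≢t len eq eqₕ _ refl

  -- Here `e` is the rise of the loser's LCP, 0 when `h₁` and `h₂` differ. The 5 covers comparing
  -- the LCPs, the last loop test (3) and returning the tuple.
  data Compared (s t : String∞) (h₁ h₂ : ℕ) : Run (Side × ℕ × Side × ℕ) → Set (a ⊔ ℓ) where
    leftFirst  : ∀ e {h′ k τ} → h′ ≡ e + h₂ → s <[ h′ ] t → k ≤ suc e → τ ≤ 5 + e * 5 →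
                 Compared s t h₁ h₂ (run (left , h₁ , right , h′) k τ)
    rightFirst : ∀ e {h′ k τ} → h′ ≡ e + h₁ → t <[ h′ ] s → k ≤ suc e → τ ≤ 5 + e * 5 →
                 Compared s t h₁ h₂ (run (right , h₂ , left , h′) k τ)

  -- At position `h₁` the string `s` already exceeds the predecessor, while `t` still agrees with
  -- it.
  follows-<-follows : ∀ {p} → Follows p h₁ s → Follows p h₂ t → h₁ <ℕ h₂ → t <[ h₁ ] s
  follows-<-follows {t = t} (after (eq₁ , lt₁)) (after (eq₂ , _)) h₁<h₂ =
    (λ i i<h₁ → trans (sym (eq₂ i (<-trans i<h₁ h₁<h₂))) (eq₁ i i<h₁)) ,
    subst (_<± _) (eq₂ _ h₁<h₂) lt₁

  follows-agree : ∀ {p} → Follows p h s → Follows p h t → AgreeBefore h s t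
  follows-agree start             _                 _ ()
  follows-agree (after (eq₁ , _)) (after (eq₂ , _)) i i<h = trans (sym (eq₁ i i<h)) (eq₂ i i<h)

  lcpCompareEqual-correct : ∀ {r} → Scanned s t h r →
                            let c = lcpCompareEqual left h right h (result r) in
                            Compared s t h h (run (result c)
                              (comparisons r + comparisons c) (1 + (time r + time c)))
  lcpCompareEqual-correct (before e eq lt) = leftFirst e eq lt
    (≤-reflexive (+-identityʳ _)) (≤-reflexive (cong (4 +_) (+-comm (e * 5) 1)))
  lcpCompareEqual-correct (behind e eq lt) = rightFirst e eq lt
    (≤-reflexive (+-identityʳ _)) (≤-reflexive (cong (4 +_) (+-comm (e * 5) 1)))

  lcpCompare-correct : ∀ {p} → Follows p h₁ s → Follows p h₂ t → s ≢ t →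
                       Compared s t h₁ h₂ (lcpCompare (left , s , h₁) (right , t , h₂))
  lcpCompare-correct {h₁} {s} {h₂} {t} f₁ f₂ s≢t with <-cmp h₁ h₂
  ... | tri< h₁<h₂ _ _ =
    rightFirst 0 refl (follows-<-follows f₁ f₂ h₁<h₂) z≤n (s≤s (s≤s z≤n))
  ... | tri> _ _ h₂<h₁ =
    leftFirst 0 refl (follows-<-follows f₂ f₁ h₂<h₁) z≤n (s≤s (s≤s z≤n))
  ... | tri≈ _ refl _ = lcpCompareEqual-correct
    (scan-correct (length∞ s) s t h₁ s≢t (m≤n+m _ h₁) (follows-agree f₁ f₂))

  -- Merging

  -- `available` is the LCP total held by the remaining inputs, with each head counted by its LCP
  -- with the last output. Only successful equality tests add to it.
  record Merged (p : Maybe String) (available n : ℕ) (S : List String) (r : Run Annotated)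
         : Set (a ⊔ ℓ) where
    field
      chain           : Chain p (result r)
      permutation     : strings (result r) ↭ S
      equalities      : ℕ
      lcp-sum         : equalities + available ≡ sum (lcps (result r))
      few-comparisons : comparisons r ≤ equalities + n
      fast            : time r ≤ 1 + n * 12 + equalities * 5

  private
    -- The output takes `h₁`, the next entry `c` becomes the winner's current LCP, and the loser's
    -- rises from `h₂` to `e + h₂`.
    lcp-left : ∀ e e′ h₁ c l h₂ m → e + e′ + ((h₁ + (c + l)) + (h₂ + m)) ≡
                                    h₁ + (e′ + ((c + l) + ((e + h₂) + m)))
    lcp-left = solve-∀

    lcp-right : ∀ e e′ h₁ l h₂ c m → e + e′ + ((h₁ + l) + (h₂ + (c + m))) ≡
                                     h₂ + (e′ + (((e + h₁) + l) + (c + m)))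
    lcp-right = solve-∀

    stepComparisons : ∀ e e′ n {k k′} → k ≤ suc e → k′ ≤ e′ + n → k + (k′ + 0) ≤ e + e′ + suc n
    stepComparisons e e′ n k≤ k′≤ =
      ≤-trans (+-mono-≤ k≤ (+-monoˡ-≤ 0 k′≤)) (≤-reflexive (regroup e e′ n))
      where
      regroup : ∀ e e′ n → suc e + (e′ + n + 0) ≡ e + e′ + suc n
      regroup = solve-∀

    -- The 12 per output string: 3 operations before the comparison, 5 in it besides the equalities,
    -- and 4 in `mergeStep`.
    stepTime : ∀ e e′ n {τ τ′} → τ ≤ 5 + e * 5 → τ′ ≤ 1 + n * 12 + e′ * 5 →
               3 + (τ + (3 + (τ′ + 1))) ≤ 1 + suc n * 12 + (e + e′) * 5
    stepTime e e′ n τ≤ τ′≤ =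
      ≤-trans (+-monoʳ-≤ 3 (+-mono-≤ τ≤ (+-monoʳ-≤ 3 (+-monoˡ-≤ 1 τ′≤))))
        (≤-reflexive (regroup e e′ n))
      where
      regroup : ∀ e e′ n → 3 + ((5 + e * 5) + (3 + ((1 + n * 12 + e′ * 5) + 1))) ≡
                           1 + suc n * 12 + (e + e′) * 5
      regroup = solve-∀

  -- Both heads are `∞` only when no input remains, and two finite heads differ by disjointness.
  currents-distinct : ∀ S T {n} → Disjoint (strings S) (strings T) →
                      length S + length T ≡ suc n → current S ≢ current T
  currents-distinct []      []      _   ()
  currents-distinct []      (_ ∷ _) _   _ ()
  currents-distinct (_ ∷ _) []      _   _ ()
  currents-distinct (_ ∷ _) (_ ∷ _) dis _ refl = dis (here refl , here refl)

  -- The heads are measured against the common last output `p`, the stored entries against the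
  -- predecessors `q₁`, `q₂` within each input.
  mergeLoop-correct :
    ∀ n S₁ h₁ S₂ h₂ {p q₁ q₂} → length S₁ + length S₂ ≡ n →
    Follows p h₁ (current S₁) → Chain q₁ S₁ → Follows p h₂ (current S₂) → Chain q₂ S₂ →
    Disjoint (strings S₁) (strings S₂) →
    Merged p ((h₁ + L (lcps S₁)) + (h₂ + L (lcps S₂))) n (strings S₁ ++ strings S₂)
      (mergeLoop n S₁ h₁ S₂ h₂)

  -- Abstracting the outcome `r` allows matching on `Compared`; `ops 3` stands for the operations
  -- before the comparison.
  mergeStep-correct :
    ∀ n S₁ h₁ S₂ h₂ {p q₁ q₂ r} → length S₁ + length S₂ ≡ suc n →
    Follows p h₁ (current S₁) → Chain q₁ S₁ → Follows p h₂ (current S₂) → Chain q₂ S₂ →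
    Disjoint (strings S₁) (strings S₂) → Compared (current S₁) (current S₂) h₁ h₂ r →
    Merged p ((h₁ + L (lcps S₁)) + (h₂ + L (lcps S₂))) (suc n) (strings S₁ ++ strings S₂)
      (ops 3 r >>= λ r → r >>= mergeStep n S₁ h₁ S₂ h₂)

  mergeLoop-correct zero [] h₁ [] h₂ _ f₁ _ f₂ _ _ = record
    { chain = []
    ; permutation = refl
    ; equalities = 0
    -- Both inputs have reached the sentinel, so `h₁` and `h₂` are 0.
    ; lcp-sum = cong₂ (λ i j → (i + 0) + (j + 0)) (follows-∞ f₁) (follows-∞ f₂)
    ; few-comparisons = z≤n
    ; fast = s≤s z≤n
    }
  mergeLoop-correct (suc n) S₁ h₁ S₂ h₂ len f₁ c₁ f₂ c₂ dis =
    mergeStep-correct n S₁ h₁ S₂ h₂ len f₁ c₁ f₂ c₂ dis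
      (lcpCompare-correct f₁ f₂ (currents-distinct S₁ S₂ dis len))

  sum-lcps : ∀ S → sum (lcps S) ≡ currentLCP S + L (lcps S)
  sum-lcps []      = refl
  sum-lcps (_ ∷ _) = refl

  -- An exhausted input never wins: no character exceeds `⊤±`.
  mergeStep-correct n [] _ _ _ _ _ _ _ _ _ (leftFirst _ _ (_ , ()) _ _)
  mergeStep-correct n ((x , _) ∷ S₁) h₁ S₂ h₂ len f₁ (_ ∷ c₁) f₂ c₂ dis
                    (leftFirst e {h′} refl lt k≤ τ≤) = record
    { chain = f₁ ∷ M.chain
    ; permutation = prep x M.permutation
    ; equalities = e + M.equalities
    ; lcp-sum = trans (cong (λ l → e + M.equalities + ((h₁ + l) + (h₂ + L (lcps S₂)))) (sum-lcps S₁))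
        (trans (lcp-left e M.equalities h₁ (currentLCP S₁) (L (lcps S₁)) h₂ (L (lcps S₂)))
          (cong (h₁ +_) M.lcp-sum))
    ; few-comparisons = stepComparisons e M.equalities n k≤ M.few-comparisons
    ; fast = stepTime e M.equalities n τ≤ M.fast
    }
    where
    -- Once `x` is output, the next stored entry of `S₁` is already an LCP with the last output;
    -- `lt` provides the same for `S₂`.
    module M = Merged (mergeLoop-correct n S₁ (currentLCP S₁) S₂ h′ (suc-injective len)
      (chain-current c₁) c₁ (after lt) c₂ (λ (v∈S₁ , v∈S₂) → dis (there v∈S₁ , v∈S₂)))
  mergeStep-correct n S₁ _ [] _ _ _ _ _ _ _ (rightFirst _ _ (_ , ()) _ _)
  mergeStep-correct n S₁ h₁ ((y , _) ∷ S₂) h₂ len f₁ c₁ f₂ (_ ∷ c₂) dis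
                    (rightFirst e {h′} refl lt k≤ τ≤) = record
    { chain = f₂ ∷ M.chain
    ; permutation = ↭-trans (prep y M.permutation) (↭-sym (shift y (strings S₁) (strings S₂)))
    ; equalities = e + M.equalities
    ; lcp-sum = trans (cong (λ l → e + M.equalities + ((h₁ + L (lcps S₁)) + (h₂ + l))) (sum-lcps S₂))
        (trans (lcp-right e M.equalities h₁ (L (lcps S₁)) h₂ (currentLCP S₂) (L (lcps S₂)))
          (cong (h₂ +_) M.lcp-sum))
    ; few-comparisons = stepComparisons e M.equalities n k≤ M.few-comparisons
    ; fast = stepTime e M.equalities n τ≤ M.fast
    }
    where
    module M = Merged (mergeLoop-correct n S₁ h′ S₂ (currentLCP S₂)
      (suc-injective (trans (sym (+-suc (length S₁) (length S₂))) len))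
      (after lt) c₁ (chain-current c₂) c₂ (λ (v∈S₁ , v∈S₂) → dis (v∈S₁ , there v∈S₂)))

  -- Mergesort

  -- Time is measured by L(H), which telescopes over the merges; D enters only at the end.
  record Sorts (S : List String) (r : Run Annotated) : Set (a ⊔ ℓ) where
    field
      chain           : Chain nothing (result r)
      permutation     : strings (result r) ↭ S
      few-comparisons : comparisons r ≤ L (lcps (result r)) + length S * ⌈log₂ length S ⌉
      fast            : time r ≤ 1 + L (lcps (result r)) * 5 + length S * ⌈log₂ length S ⌉ * 14

  length-halves : ∀ S → length (firstHalf S) + length (secondHalf S) ≡ length S
  length-halves S = trans (sym (length-++ (firstHalf S)))
    (cong length (take++drop≡id ⌊ length S /2⌋ S))

  private
    -- Halving lowers the rounded logarithm by one, which frees `n` to pay for the merge.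
    levelCost : ∀ {n₁ n₂ n} → n₁ + n₂ ≡ n → 2 ≤ n → n₁ ≤ ⌈ n /2⌉ → n₂ ≤ ⌈ n /2⌉ →
                n₁ * ⌈log₂ n₁ ⌉ + n₂ * ⌈log₂ n₂ ⌉ + n ≤ n * ⌈log₂ n ⌉
    levelCost {n₁} {n₂} {n} refl 2≤n n₁≤ n₂≤ = begin
      n₁ * ⌈log₂ n₁ ⌉ + n₂ * ⌈log₂ n₂ ⌉ + n
        ≤⟨ +-monoˡ-≤ n (+-mono-≤ (*-monoʳ-≤ n₁ (shallower n₁≤)) (*-monoʳ-≤ n₂ (shallower n₂≤))) ⟩
      n₁ * d + n₂ * d + n ≡⟨ cong (_+ n) (*-distribʳ-+ d n₁ n₂) ⟨
      n * d + n           ≡⟨ +-comm (n * d) n ⟩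
      n + n * d           ≡⟨ *-suc n d ⟨
      -- As `2 ≤ n`, the logarithm is at least 1 and the truncated subtraction in `d` is exact.
      n * suc d           ≡⟨ cong (n *_) (m+[n∸m]≡n (⌈log₂⌉-mono-≤ 2≤n)) ⟩
      n * ⌈log₂ n ⌉       ∎
      where
      open ≤-Reasoning
      d = ⌈log₂ n ⌉ ∸ 1
      shallower : ∀ {m} → m ≤ ⌈ n /2⌉ → ⌈log₂ m ⌉ ≤ d
      shallower m≤ = ≤-trans (⌈log₂⌉-mono-≤ m≤) (≤-reflexive (⌈log₂⌈n/2⌉⌉≡⌈log₂n⌉∸1 n))

    sortComparisons : ∀ {L₁ L₂ E L N₁ N₂ N n k₁ k₂ k} →
                      N₁ + N₂ + n ≤ N → E + (L₁ + L₂) ≡ L →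
                      k₁ ≤ L₁ + N₁ → k₂ ≤ L₂ + N₂ → k ≤ E + n → k₁ + (k₂ + k) ≤ L + N
    sortComparisons {L₁} {L₂} {E} {L} {N₁} {N₂} {N} {n} {k₁} {k₂} {k} level refl k₁≤ k₂≤ k≤ = begin
      k₁ + (k₂ + k)                       ≤⟨ +-mono-≤ k₁≤ (+-mono-≤ k₂≤ k≤) ⟩
      (L₁ + N₁) + ((L₂ + N₂) + (E + n))   ≡⟨ regroup L₁ L₂ E N₁ N₂ n ⟩
      E + (L₁ + L₂) + (N₁ + N₂ + n)       ≤⟨ +-monoʳ-≤ (E + (L₁ + L₂)) level ⟩
      E + (L₁ + L₂) + N                   ∎
      where
      open ≤-Reasoning
      regroup : ∀ L₁ L₂ E N₁ N₂ n → (L₁ + N₁) + ((L₂ + N₂) + (E + n)) ≡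
                                    E + (L₁ + L₂) + (N₁ + N₂ + n)
      regroup = solve-∀

    -- Each level costs 14 n, the constants of the two calls and of the merge
    -- being absorbed by n ≥ 2.
    sortTime : ∀ {L₁ L₂ E L N₁ N₂ N n τ₁ τ₂ τ} → 2 ≤ n →
               N₁ + N₂ + n ≤ N → E + (L₁ + L₂) ≡ L →
               τ₁ ≤ 1 + L₁ * 5 + N₁ * 14 → τ₂ ≤ 1 + L₂ * 5 + N₂ * 14 →
               τ ≤ 1 + n * 12 + E * 5 → n + (τ₁ + (τ₂ + τ)) ≤ 1 + L * 5 + N * 14
    sortTime {L₁} {L₂} {E} {L} {N₁} {N₂} {N} {n} {τ₁} {τ₂} {τ} 2≤n level refl τ₁≤ τ₂≤ τ≤ = begin
      n + (τ₁ + (τ₂ + τ))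
        ≤⟨ +-monoʳ-≤ n (+-mono-≤ τ₁≤ (+-mono-≤ τ₂≤ τ≤)) ⟩
      n + ((1 + L₁ * 5 + N₁ * 14) + ((1 + L₂ * 5 + N₂ * 14) + (1 + n * 12 + E * 5)))
        ≡⟨ collect L₁ L₂ E N₁ N₂ n ⟩
      2 + (1 + (E + (L₁ + L₂)) * 5 + ((N₁ + N₂) * 14 + n * 13))
        ≤⟨ +-monoˡ-≤ _ 2≤n ⟩
      n + (1 + (E + (L₁ + L₂)) * 5 + ((N₁ + N₂) * 14 + n * 13))
        ≡⟨ absorb (E + (L₁ + L₂)) (N₁ + N₂) n ⟩
      1 + (E + (L₁ + L₂)) * 5 + (N₁ + N₂ + n) * 14
        ≤⟨ +-monoʳ-≤ (1 + (E + (L₁ + L₂)) * 5) (*-monoˡ-≤ 14 level) ⟩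
      1 + (E + (L₁ + L₂)) * 5 + N * 14 ∎
      where
      open ≤-Reasoning
      collect : ∀ L₁ L₂ E N₁ N₂ n →
        n + ((1 + L₁ * 5 + N₁ * 14) + ((1 + L₂ * 5 + N₂ * 14) + (1 + n * 12 + E * 5))) ≡
        2 + (1 + (E + (L₁ + L₂)) * 5 + ((N₁ + N₂) * 14 + n * 13))
      collect = solve-∀
      absorb : ∀ X N n → n + (1 + X * 5 + (N * 14 + n * 13)) ≡ 1 + X * 5 + (N + n) * 14
      absorb = solve-∀

  mergesort-correct : ∀ S (rs : Acc _<ℕ_ (length S)) → Unique S → Sorts S (mergesortAcc S rs)
  mergesort-correct [] _ _ = record
    { chain = [] ; permutation = refl ; few-comparisons = z≤n ; fast = s≤s z≤n }
  mergesort-correct (_ ∷ []) _ _ = record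
    { chain = start ∷ [] ; permutation = refl ; few-comparisons = z≤n ; fast = s≤s z≤n }
  mergesort-correct S@(x ∷ y ∷ S′) (acc rs) unique = record
    { chain = M.chain
    ; permutation = ↭-trans M.permutation
        (subst (strings T₁ ++ strings T₂ ↭_) split (++⁺ First.permutation Second.permutation))
    ; few-comparisons =
        sortComparisons {L₁ = L (lcps T₁)} {L₂ = L (lcps T₂)} {E = M.equalities} {N₁ = N₁} {N₂}
          level lcp-sum First.few-comparisons Second.few-comparisons
          (subst (λ m → comparisons (lcpMerge T₁ T₂) ≤ M.equalities + m) sizes M.few-comparisons)
    ; fast =
        sortTime {L₁ = L (lcps T₁)} {L₂ = L (lcps T₂)} {E = M.equalities} {N₁ = N₁} {N₂} (s≤s (s≤s z≤n))
          level lcp-sum First.fast Second.fast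
          (subst (λ m → time (lcpMerge T₁ T₂) ≤ 1 + m * 12 + M.equalities * 5) sizes M.fast)
    }
    where
    n = length S
    half = ⌊ n /2⌋
    split = take++drop≡id half S

    R₁ = mergesortAcc (firstHalf S) (rs (firstHalf-shorter x y S′))
    R₂ = mergesortAcc (secondHalf S) (rs (secondHalf-shorter x y S′))
    T₁ = result R₁
    T₂ = result R₂

    module First = Sorts (mergesort-correct (firstHalf S)
      (rs (firstHalf-shorter x y S′)) (take⁺ half unique))
    module Second = Sorts (mergesort-correct (secondHalf S)
      (rs (secondHalf-shorter x y S′)) (drop⁺ half unique))

    -- Uniqueness of the whole input separates the halves, and sorting only permutes each.
    disjoint : Disjoint (strings T₁) (strings T₂)
    disjoint (v∈T₁ , v∈T₂) =
      Unique-++⇒Disjoint (firstHalf S) (subst Unique (sym split) unique)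
        (∈-resp-↭ First.permutation v∈T₁ , ∈-resp-↭ Second.permutation v∈T₂)

    module M = Merged (mergeLoop-correct _ T₁ 0 T₂ 0 refl
      (start {s = current T₁}) First.chain (start {s = current T₂}) Second.chain disjoint)

    lcp-sum : M.equalities + (L (lcps T₁) + L (lcps T₂)) ≡ L (lcps (result (lcpMerge T₁ T₂)))
    lcp-sum = trans M.lcp-sum (chain-L M.chain)

    length-sorted : ∀ {U T} → strings T ↭ U → length T ≡ length U
    length-sorted {T = T} perm = trans (sym (length-map proj₁ T)) (↭-length perm)

    sizes : length T₁ + length T₂ ≡ n
    sizes = trans (cong₂ _+_ (length-sorted First.permutation) (length-sorted Second.permutation))
      (length-halves S)

    N₁ = length (firstHalf S) * ⌈log₂ length (firstHalf S) ⌉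
    N₂ = length (secondHalf S) * ⌈log₂ length (secondHalf S) ⌉

    level : N₁ + N₂ + n ≤ n * ⌈log₂ n ⌉
    level = levelCost (length-halves S) (s≤s (s≤s z≤n))
      (≤-trans (≤-reflexive (length-take half S)) (≤-trans (m⊓n≤m half n) (⌊n/2⌋≤⌈n/2⌉ n)))
      (≤-reflexive (trans (length-drop half S)
        (trans (cong (_∸ half) (sym (⌊n/2⌋+⌈n/2⌉≡n n))) (m+n∸m≡n half ⌈ n /2⌉))))

  -- The total time in terms of D and n log n

  totalTime : ∀ {l δ N τ} → l ≤ δ → 1 ≤ N → τ ≤ 1 + l * 5 + N * 14 → τ ≤ 15 * (δ + N)
  totalTime {l} {δ} {N} {τ} l≤δ 1≤N τ≤ = begin
    τ                    ≤⟨ τ≤ ⟩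
    1 + l * 5 + N * 14   ≤⟨ +-monoˡ-≤ (N * 14) (+-mono-≤ 1≤N (*-mono-≤ l≤δ (m≤m+n 5 10))) ⟩
    N + δ * 15 + N * 14  ≡⟨ regroup δ N ⟩
    15 * (δ + N)         ∎
    where
    open ≤-Reasoning
    regroup : ∀ δ N → N + δ * 15 + N * 14 ≡ 15 * (δ + N)
    regroup = solve-∀

mainTheorem3 : ∀ {a ℓ} → ∃ λ (C : ℕ) →
    (A : Set a) (_<_ : Rel A ℓ) (isSTO : IsStrictTotalOrder _≡_ _<_) →
    let open LCPMergesort isSTO in
    (S : List String) → Unique S →
    let n      = length S
        output = lcpMergesort S
        sorted = strings (result output)
        H      = lcps (result output)
    in
      Sorted stringOrder sorted
      × sorted ↭ S
      × H ≡ lcpArray sorted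
      × comparisons output ≤ L H + n * ⌈log₂ n ⌉
      × (2 ≤ n → time output ≤ C * (D S + n * ⌈log₂ n ⌉))
mainTheorem3 = 15 , λ A _<_ isSTO S unique →
  let open Correctness isSTO
      open Sorts (mergesort-correct S (<-wellFounded (length S)) unique)
  in
  chain-sorted chain , permutation , chain-lcpArray chain , few-comparisons ,
  -- For n at most 1 both D and n log n vanish; from n = 2 on, n log n is at least 1 and absorbs the
  -- additive constant, whence 15 = 14 + 1.
  λ 2≤n → totalTime (L≤D S chain permutation)
    (*-mono-≤ (≤-trans (s≤s z≤n) 2≤n) (⌈log₂⌉-mono-≤ 2≤n)) fast
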